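{- Let $\Delta$ be a simplicial complex of dimension $d\ge 1$. I. If $\Delta$ is vertex-chordal then $\Delta$ is E-chordal; if $\Delta$ is E-chordal then $\Delta$ is ridge-chordal. Both implications are strict: there is an E-chordal complex that is not vertex-chordal, and a ridge-chordal complex that is not E-chordal. II. If $\Delta$ is pure, then $\Delta$ is vertex-chordal if and only if $\Delta$ is E-chordal.
   Context: Simplicial complexes are finite and not necessarily pure. A vertex labeling of a complex with $n$ vertices is a bijection of its vertices with $[n]$; $\max F$ is the largest label in $F$; the size of a face is its number of vertices. $\Delta$ is E-chordal if it has a labeling such that for every two facets $F\ne G$ with the same size and same maximum, every subset $H\subseteq F\cup G$ with $|H|=|F|$ is a face of $\Delta$. A $t$-clique of a complex $\Gamma$ is a set $X$ of vertices such that any $k+1\le t+1$ vertices of $X$ span a $k$-face of $\Gamma$. A face of $\Gamma$ is $t$-simplicial if the vertices of its star in $\Gamma$ form a $t$-clique of $\Gamma$. Deleting above a face $F$ of $\Gamma$ means passing to the complex $\operatorname{abdel}(F,\Gamma)$ whose facets are the facets of $\Gamma$ not containing $F$. The empty set has dimension $-1$. For $0\le j<d$, a $d$-dimensional complex $\Delta$ is $j$-face-chordal if it can be reduced to a complex of dimension $\le j$ by repeatedly deleting above a $j$-face that is $d$-simplicial in the current complex (here $d$ is always the dimension of the original $\Delta$). Vertex-chordal means $0$-face-chordal; ridge-chordal means $(d-1)$-face-chordal. -}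

module Defs where

open import Data.Fin.Base as Fin using (Fin)
open import Data.Fin.Subset
  using (Subset; _∈_; _⊆_; _⊈_; _⊂_; _∪_; ⁅_⁆; ∣_∣)
open import Data.Fin.Subset.Properties
  using (_⊆?_; _⊂?_; anySubset?; ⊆-trans; x∈p∪q⁺; x∈p∪q⁻)
open import Data.Nat.Base using (ℕ; suc; _≤_; _<_)
open import Data.Product.Base using (Σ-syntax; ∃-syntax; _×_; _,_; proj₁)
open import Data.Sum.Base as Sum using ()
open import Data.Vec.Base using (tabulate)
open import Function.Base using (id)
open import Function.Bundles using (_⤖_; Bijection)
open import Level using (0ℓ)
open import Relation.Binary.Construct.Closure.ReflexiveTransitive using (Star)
open import Relation.Binary.PropositionalEquality using (_≡_; _≢_)
open import Relation.Nullary using (¬_; does)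
open import Relation.Nullary.Decidable using (_×-dec_; ¬?)
open import Relation.Unary using (Pred; Decidable)

private
  variable
    N : ℕ

-- A finite simplicial complex whose vertices are some, not necessarily all,
-- of the elements of Fin N (deleting faces may remove vertices).  The family
-- of faces is allowed to be empty, since abdel below may leave no facets.

record SimplicialComplex (N : ℕ) : Set₁ where
  field
    Face       : Pred (Subset N) 0ℓ
    Face?      : Decidable Face
    downClosed : ∀ {F G} → F ⊆ G → Face G → Face F

open SimplicialComplex public

vertices : SimplicialComplex N → Subset N
vertices Γ = tabulate λ v → does (Face? Γ ⁅ v ⁆)

Vertex : SimplicialComplex N → Set
Vertex Γ = ∃[ v ] v ∈ vertices Γ

IsFacet : SimplicialComplex N → Pred (Subset N) 0ℓ
IsFacet Γ F = Face Γ F × ¬ (∃[ G ] Face Γ G × F ⊂ G)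

isFacet? : (Γ : SimplicialComplex N) → Decidable (IsFacet Γ)
isFacet? Γ F =
  Face? Γ F ×-dec ¬? (anySubset? λ G → Face? Γ G ×-dec F ⊂? G)

-- A face of dimension k has suc k elements.  DimAtMost k also covers the
-- complexes of dimension -1.

DimAtMost : ℕ → SimplicialComplex N → Set
DimAtMost k Γ = ∀ F → Face Γ F → ∣ F ∣ ≤ suc k

HasDim : ℕ → SimplicialComplex N → Set
HasDim d Γ = DimAtMost d Γ × (∃[ F ] Face Γ F × ∣ F ∣ ≡ suc d)

Pure : SimplicialComplex N → Set
Pure Γ = ∀ F G → IsFacet Γ F → IsFacet Γ G → ∣ F ∣ ≡ ∣ G ∣

-- The label set [n] is Fin n, with its usual order.

Labeling : SimplicialComplex N → Set
Labeling Γ = Vertex Γ ⤖ Fin ∣ vertices Γ ∣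

module _ (Γ : SimplicialComplex N) (ℓ : Labeling Γ) where

  open Bijection ℓ using () renaming (to to label)

  -- m is max F, the largest label of a vertex in F.
  IsMax : Subset N → Fin ∣ vertices Γ ∣ → Set
  IsMax F m = (Σ[ v ∈ Vertex Γ ] proj₁ v ∈ F × label v ≡ m)
            × (∀ (v : Vertex Γ) → proj₁ v ∈ F → label v Fin.≤ m)

  SameMax : Subset N → Subset N → Set
  SameMax F G = ∃[ m ] IsMax F m × IsMax G m

EChordal : SimplicialComplex N → Set
EChordal Δ = Σ[ ℓ ∈ Labeling Δ ] (∀ F G → IsFacet Δ F → IsFacet Δ G →
  F ≢ G → ∣ F ∣ ≡ ∣ G ∣ → SameMax Δ ℓ F G →
  ∀ H → H ⊆ F ∪ G → ∣ H ∣ ≡ ∣ F ∣ → Face Δ H)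

IsClique : ℕ → SimplicialComplex N → Subset N → Set
IsClique t Γ X = X ⊆ vertices Γ
  × (∀ k → k ≤ t → ∀ Y → Y ⊆ X → ∣ Y ∣ ≡ suc k → Face Γ Y)

star : Subset N → SimplicialComplex N → SimplicialComplex N
star F Γ = record
  { Face       = λ G → Face Γ (F ∪ G)
  ; Face?      = λ G → Face? Γ (F ∪ G)
  ; downClosed = λ {G} {H} G⊆H → downClosed Γ
      λ x∈F∪G → x∈p∪q⁺ (Sum.map id G⊆H (x∈p∪q⁻ F G x∈F∪G))
  }

IsSimplicial : ℕ → SimplicialComplex N → Subset N → Set
IsSimplicial t Γ F = Face Γ F × IsClique t Γ (vertices (star F Γ))

-- The complex generated by the facets of Γ that do not contain F.

abdel : Subset N → SimplicialComplex N → SimplicialComplex N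
abdel F Γ = record
  { Face       = λ H → ∃[ G ] (IsFacet Γ G × F ⊈ G) × H ⊆ G
  ; Face?      = λ H →
      anySubset? λ G → (isFacet? Γ G ×-dec ¬? (F ⊆? G)) ×-dec H ⊆? G
  ; downClosed = λ { H⊆K (G , p , K⊆G) → G , p , ⊆-trans H⊆K K⊆G }
  }

data _,_⊢_⟶_ (j d : ℕ) {N} (Γ : SimplicialComplex N) :
             SimplicialComplex N → Set₁ where
  delete : ∀ F → ∣ F ∣ ≡ suc j → IsSimplicial d Γ F →
           j , d ⊢ Γ ⟶ abdel F Γ

FaceChordal : ℕ → SimplicialComplex N → Set₁
FaceChordal j Δ = ∃[ d ] HasDim d Δ × j < d
  × (∃[ Γ ] Star (j , d ⊢_⟶_) Δ Γ × DimAtMost j Γ)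

VertexChordal : SimplicialComplex N → Set₁
VertexChordal = FaceChordal 0

RidgeChordal : SimplicialComplex N → Set₁
RidgeChordal Δ = ∃[ j ] HasDim (suc j) Δ × FaceChordal j Δ

{-# OPTIONS --safe #-}

-- A vertex elimination sequence, read backwards, is a labeling: facets F ≠ G with
-- the same maximum v lie in the star of v at the moment v is eliminated, which is
-- a clique.  Conversely, if Δ of dimension d is E-chordal and W is the union of the
-- d-faces with maximum v, then exchanging vertices between two such faces shows
-- that every (d+1)-subset of W is a face.  For pure Δ one may therefore eliminate
-- the vertices from the largest label down.  In general, write each d-face as
-- R ∪ {a} with a its smallest vertex and delete above the lexicographically largest
-- such R: the star of R then consists of R and of vertices below R, so its
-- (d+1)-subsets, which are faces of Δ, have not been destroyed yet.
--
-- A filled triangle all of whose vertices are joined to a fourth one is E-chordal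
-- when the fourth vertex comes first, but none of its vertices is simplicial.  A
-- filled triangle attached to an empty square is reduced by one ridge deletion,
-- while the square obstructs every labeling.

module Submission where

open import Defs
open import Algebra.Properties.CommutativeSemigroup using (x∙yz≈y∙xz)
open import Data.Bool.Base using (if_then_else_)
import Data.Bool.Properties as Bool
open import Data.Empty using (⊥-elim)
open import Data.Fin.Base as Fin using (Fin; zero; suc; toℕ; fromℕ<; punchOut)
open import Data.Fin.Patterns using (0F; 1F; 2F; 3F; 4F; 5F)
import Data.Fin.Properties as Fin
open import Data.Fin.Subset
open import Data.Fin.Subset.Properties
open import Data.List.Base as List using (List; []; _∷_; allFin)
open import Data.List.Membership.Propositional using (find) renaming (_∈_ to _∈ˡ_)
open import Data.List.Membership.Propositional.Properties using (∈-map⁻)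
open import Data.List.Relation.Unary.All as All using (All)
open import Data.List.Relation.Unary.Any as Any using (Any; here; there)
open import Data.Nat.Base
  using (ℕ; zero; suc; _+_; _*_; _^_; _∸_; _≤_; _<_; z≤n; s≤s; s≤s⁻¹)
open import Data.Nat.Induction using (<-rec)
open import Data.Nat.Properties
open import Data.Product.Base using (Σ-syntax; ∃; ∃-syntax; _×_; _,_; proj₁; proj₂; map₂)
open import Data.Sum.Base using (_⊎_; inj₁; inj₂; [_,_]′)
open import Data.Vec.Base using ([]; _∷_; tabulate; here; there)
open import Data.Vec.Properties using ([]=⇒lookup; lookup⇒[]=; lookup∘tabulate; ≡-dec)
open import Data.Vec.Properties.WithK using ([]=-irrelevant)
open import Function.Base using (_∘_; id)
open import Function.Bundles using (_⇔_; Bijection; mk⤖; mk⇔)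
open import Function.Definitions using (Injective)
open import Level using (0ℓ)
open import Relation.Binary.Construct.Closure.ReflexiveTransitive using (Star; ε; _◅_)
open import Relation.Binary.PropositionalEquality
open import Relation.Nullary using (¬_; Dec; yes; no; does)
open import Relation.Nullary.Decidable
  using (_×-dec_; _→-dec_; ¬?; map′; dec-true; decidable-stable; from-yes; from-no)
open import Relation.Unary using (Pred; Decidable)

private
  variable
    N n : ℕ

-- Elements and sizes of finite subsets.

x∉p-x : (p : Subset N) {x : Fin N} → x ∉ p - x
x∉p-x (_ ∷ _) {zero}  ()
x∉p-x (_ ∷ p) {suc x} (there x∈) = x∉p-x p x∈

∣p∪⁅x⁆∣ : (p : Subset N) {x : Fin N} → x ∉ p → ∣ p ∪ ⁅ x ⁆ ∣ ≡ suc ∣ p ∣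
∣p∪⁅x⁆∣ (inside  ∷ p) {zero}  x∉p = ⊥-elim (x∉p here)
∣p∪⁅x⁆∣ (outside ∷ p) {zero}  x∉p = cong (suc ∘ ∣_∣) (∪-identityʳ p)
∣p∪⁅x⁆∣ (inside  ∷ p) {suc x} x∉p = cong suc (∣p∪⁅x⁆∣ p (x∉p ∘ there))
∣p∪⁅x⁆∣ (outside ∷ p) {suc x} x∉p = ∣p∪⁅x⁆∣ p (x∉p ∘ there)

x∈p∪⁅y⁆⁻ : (p : Subset N) {x y : Fin N} → x ∈ p ∪ ⁅ y ⁆ → x ∈ p ⊎ x ≡ y
x∈p∪⁅y⁆⁻ p {y = y} x∈ with x∈p∪q⁻ p ⁅ y ⁆ x∈
... | inj₁ x∈p = inj₁ x∈p
... | inj₂ x∈y = inj₂ (x∈⁅y⁆⇒x≡y y x∈y)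

∪-⊆ : {p q r : Subset N} → p ⊆ r → q ⊆ r → p ∪ q ⊆ r
∪-⊆ {p = p} {q} p⊆r q⊆r x∈ = [ p⊆r , q⊆r ]′ (x∈p∪q⁻ p q x∈)

⁅x⁆⊆p : {p : Subset N} {x : Fin N} → x ∈ p → ⁅ x ⁆ ⊆ p
⁅x⁆⊆p {x = x} x∈p y∈ with refl ← x∈⁅y⁆⇒x≡y x y∈ = x∈p

y∈p∪⁅y⁆ : (p : Subset N) {y : Fin N} → y ∈ p ∪ ⁅ y ⁆
y∈p∪⁅y⁆ p {y} = q⊆p∪q p ⁅ y ⁆ (x∈⁅x⁆ y)

p-x∪⁅x⁆≡p : {p : Subset N} {x : Fin N} → x ∈ p → (p - x) ∪ ⁅ x ⁆ ≡ p
p-x∪⁅x⁆≡p {p = p} {x} x∈p = ⊆-antisym (∪-⊆ (p─q⊆p p ⁅ x ⁆) (⁅x⁆⊆p x∈p)) p⊆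
  where
  p⊆ : p ⊆ (p - x) ∪ ⁅ x ⁆
  p⊆ {y} y∈p with y Fin.≟ x
  ... | yes refl = y∈p∪⁅y⁆ (p - x)
  ... | no y≢x   = p⊆p∪q ⁅ x ⁆ (x∈p∧x≢y⇒x∈p-y y∈p y≢x)

∣p-x∣ : {p : Subset N} {x : Fin N} → x ∈ p → suc ∣ p - x ∣ ≡ ∣ p ∣
∣p-x∣ {p = p} {x} x∈p =
  trans (sym (∣p∪⁅x⁆∣ (p - x) (x∉p-x p))) (cong ∣_∣ (p-x∪⁅x⁆≡p x∈p))

⊈⇒∃∉ : {p q : Subset N} → p ⊈ q → ∃[ x ] x ∈ p × x ∉ q
⊈⇒∃∉ {p = p} {q} p⊈q with Fin.any? (λ x → x ∈? p ×-dec ¬? (x ∈? q))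
... | yes found = found
... | no none   = ⊥-elim (p⊈q λ {x} x∈p →
  decidable-stable (x ∈? q) λ x∉q → none (x , x∈p , x∉q))

p⊆q∧∣q∣≤∣p∣⇒q⊆p : {p q : Subset N} → p ⊆ q → ∣ q ∣ ≤ ∣ p ∣ → q ⊆ p
p⊆q∧∣q∣≤∣p∣⇒q⊆p {p = p} {q} p⊆q q≤p {x} x∈q = decidable-stable (x ∈? p) λ x∉p →
  <⇒≱ (p⊂q⇒∣p∣<∣q∣ (p⊆q , x , x∈q , x∉p)) q≤p

p⊆q∧∣q∣≤∣p∣⇒p≡q : {p q : Subset N} → p ⊆ q → ∣ q ∣ ≤ ∣ p ∣ → p ≡ q
p⊆q∧∣q∣≤∣p∣⇒p≡q p⊆q q≤p = ⊆-antisym p⊆q (p⊆q∧∣q∣≤∣p∣⇒q⊆p p⊆q q≤p)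

∣p∣<∣q∣⇒∃∉ : {p q : Subset N} → ∣ p ∣ < ∣ q ∣ → ∃[ x ] x ∈ q × x ∉ p
∣p∣<∣q∣⇒∃∉ p<q = ⊈⇒∃∉ λ q⊆p → <⇒≱ p<q (p⊆q⇒∣p∣≤∣q∣ q⊆p)

x∈p⇒0<∣p∣ : {p : Subset N} {x : Fin N} → x ∈ p → 0 < ∣ p ∣
x∈p⇒0<∣p∣ x∈p = subst (0 <_) (∣p-x∣ x∈p) 0<1+n

0<∣p∣⇒Nonempty : {p : Subset N} → 0 < ∣ p ∣ → Nonempty p
0<∣p∣⇒Nonempty {N} {p} 0<p =
  map₂ proj₁ (∣p∣<∣q∣⇒∃∉ {p = ⊥} {p} (subst (_< ∣ p ∣) (sym (∣⊥∣≡0 N)) 0<p))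

∣p∣≤1⇒x≡y : {p : Subset N} {x y : Fin N} → ∣ p ∣ ≤ 1 → x ∈ p → y ∈ p → x ≡ y
∣p∣≤1⇒x≡y {p = p} {x} {y} p≤1 x∈p y∈p = x∈⁅y⁆⇒x≡y y
  (p⊆q∧∣q∣≤∣p∣⇒q⊆p (⁅x⁆⊆p y∈p) (subst (∣ p ∣ ≤_) (sym (∣⁅x⁆∣≡1 y)) p≤1) x∈p)

∣p∣≤1⇒p≡⁅x⁆ : {p : Subset N} {x : Fin N} → ∣ p ∣ ≤ 1 → x ∈ p → p ≡ ⁅ x ⁆
∣p∣≤1⇒p≡⁅x⁆ {x = x} p≤1 x∈p =
  ⊆-antisym (λ y∈p → subst (_∈ ⁅ x ⁆) (∣p∣≤1⇒x≡y p≤1 x∈p y∈p) (x∈⁅x⁆ x)) (⁅x⁆⊆p x∈p)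

∃-between : {p q : Subset N} {m : ℕ} → p ⊆ q → ∣ p ∣ ≤ m → m ≤ ∣ q ∣ →
            ∃[ r ] p ⊆ r × r ⊆ q × ∣ r ∣ ≡ m
∃-between {p = []} {[]} {zero} _ _ _ = [] , id , id , refl
∃-between {p = inside ∷ p} {outside ∷ q} p⊆q _ _ with () ← p⊆q here
∃-between {p = inside ∷ p} {inside ∷ q} {suc m} p⊆q (s≤s p≤m) (s≤s m≤q)
  with r , p⊆r , r⊆q , r≡m ← ∃-between (drop-∷-⊆ p⊆q) p≤m m≤q
  = inside ∷ r , in⊆in p⊆r , in⊆in r⊆q , cong suc r≡m
∃-between {p = outside ∷ p} {outside ∷ q} p⊆q p≤m m≤q
  with r , p⊆r , r⊆q , r≡m ← ∃-between (drop-∷-⊆ p⊆q) p≤m m≤q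
  = outside ∷ r , s⊆s p⊆r , s⊆s r⊆q , r≡m
∃-between {p = outside ∷ p} {inside ∷ q} {m} p⊆q p≤m m≤q with m ≤? ∣ q ∣
... | yes m≤∣q∣ with r , p⊆r , r⊆q , r≡m ← ∃-between (drop-∷-⊆ p⊆q) p≤m m≤∣q∣
  = outside ∷ r , s⊆s p⊆r , out⊆ r⊆q , r≡m
-- Here `m` exceeds the size of the tail, hence equals it plus one, and all of it is taken.
... | no m≰∣q∣ = inside ∷ q , p⊆q , id , ≤-antisym (≰⇒> m≰∣q∣) m≤q

-- Extremal elements under decidable predicates.

module _ {A : Set} (∃? : ∀ {P : Pred A 0ℓ} → Decidable P → Dec (∃ P))
         {P : Pred A 0ℓ} (P? : Decidable P) where

  -- `∃?` is a parameter so that one search serves both vertices (`Fin.any?`) and subsets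
  -- (`anySubset?`).
  minimise : (f : A → ℕ) → ∃ P → ∃[ x ] P x × (∀ y → P y → f x ≤ f y)
  minimise f (x₀ , Px₀) = <-rec Goal descend (f x₀) x₀ refl Px₀
    where
    Goal : ℕ → Set
    Goal n = ∀ x → f x ≡ n → P x → ∃[ x ] P x × (∀ y → P y → f x ≤ f y)
    descend : ∀ n → (∀ {m} → m < n → Goal m) → Goal n
    descend _ rec x refl Px with ∃? (λ y → P? y ×-dec f y <? f x)
    ... | yes (y , Py , fy<fx) = rec fy<fx y refl Py
    ... | no none = x , Px , λ y Py → ≮⇒≥ λ fy<fx → none (y , Py , fy<fx)

  maximise : (f : A → ℕ) (b : ℕ) → (∀ x → P x → f x ≤ b) → ∃ P →
             ∃[ x ] P x × (∀ y → P y → f y ≤ f x)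
  maximise f b bound ∃P with x , Px , minimal ← minimise (λ x → b ∸ f x) ∃P
    = x , Px , λ y Py →
        -- The bound `f y ≤ b` keeps truncated subtraction strictly order-reversing.
        ≮⇒≥ λ fx<fy → ≤⇒≯ (minimal y Py) (∸-monoʳ-< fx<fy (bound y Py))

-- Weights and counts of subsets.

weight : (Fin N → ℕ) → Subset N → ℕ
weight g []            = 0
weight g (inside  ∷ p) = g zero + weight (g ∘ suc) p
weight g (outside ∷ p) = weight (g ∘ suc) p

weight-mono : (g : Fin N → ℕ) {p q : Subset N} → p ⊆ q → weight g p ≤ weight g q
weight-mono g {[]}          {[]}          p⊆q = z≤n
weight-mono g {inside  ∷ p} {inside  ∷ q} p⊆q = +-monoʳ-≤ (g zero) (weight-mono _ (drop-∷-⊆ p⊆q))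
weight-mono g {inside  ∷ p} {outside ∷ q} p⊆q with () ← p⊆q here
weight-mono g {outside ∷ p} {inside  ∷ q} p⊆q = m≤n⇒m≤o+n (g zero) (weight-mono _ (drop-∷-⊆ p⊆q))
weight-mono g {outside ∷ p} {outside ∷ q} p⊆q = weight-mono _ (drop-∷-⊆ p⊆q)

weight-∪⁅x⁆ : (g : Fin N → ℕ) (p : Subset N) {x : Fin N} → x ∉ p →
              weight g (p ∪ ⁅ x ⁆) ≡ g x + weight g p
weight-∪⁅x⁆ g (inside  ∷ p) {zero}  x∉p = ⊥-elim (x∉p here)
weight-∪⁅x⁆ g (outside ∷ p) {zero}  x∉p = cong (λ q → g zero + weight (g ∘ suc) q) (∪-identityʳ p)
weight-∪⁅x⁆ g (outside ∷ p) {suc x} x∉p = weight-∪⁅x⁆ (g ∘ suc) p (x∉p ∘ there)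
weight-∪⁅x⁆ g (inside  ∷ p) {suc x} x∉p = begin
  g zero + weight (g ∘ suc) (p ∪ ⁅ x ⁆)        ≡⟨ cong (g zero +_) (weight-∪⁅x⁆ _ p (x∉p ∘ there)) ⟩
  g zero + (g (suc x) + weight (g ∘ suc) p)    ≡⟨ x∙yz≈y∙xz +-commutativeSemigroup (g zero) (g (suc x)) _ ⟩
  g (suc x) + (g zero + weight (g ∘ suc) p)    ∎
  where open ≡-Reasoning

weight-split : (g : Fin N → ℕ) {p : Subset N} {x : Fin N} → x ∈ p →
               weight g p ≡ g x + weight g (p - x)
weight-split g {p} {x} x∈p =
  trans (cong (weight g) (sym (p-x∪⁅x⁆≡p x∈p))) (weight-∪⁅x⁆ g (p - x) (x∉p-x p))

x∈p⇒g[x]≤weight : (g : Fin N → ℕ) {p : Subset N} {x : Fin N} → x ∈ p → g x ≤ weight g p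
x∈p⇒g[x]≤weight g {p} {x} x∈p = subst (g x ≤_) (sym (weight-split g x∈p)) (m≤m+n (g x) _)

-- An element of `p` is either matched by itself in `q` or contributes at most `c` after scaling by
-- `b`; the latter are counted crudely by `∣ p ∣`. The factor `b` avoids a division.
weight-≤ : (g : Fin N → ℕ) (b c : ℕ) (p q : Subset N) →
           (∀ {x} → x ∈ p → x ∈ q ⊎ b * g x ≤ c) →
           b * weight g p ≤ b * weight g q + ∣ p ∣ * c
weight-≤ g b c [] [] _ = m≤m+n (b * 0) 0
weight-≤ {suc N} g b c (t ∷ p) (s ∷ q) small = head t s small
  where
  open ≤-Reasoning
  w : Subset N → ℕ
  w = weight (g ∘ suc)
  small′ : ∀ {x} → x ∈ p → x ∈ q ⊎ b * g (suc x) ≤ c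
  small′ x∈p with small (there x∈p)
  ... | inj₁ (there x∈q) = inj₁ x∈q
  ... | inj₂ x-small     = inj₂ x-small
  tail : b * w p ≤ b * w q + ∣ p ∣ * c
  tail = weight-≤ (g ∘ suc) b c p q small′
  wq≤ : ∀ s → b * w q ≤ b * weight g (s ∷ q)
  wq≤ inside  = *-monoʳ-≤ b (m≤n+m (w q) (g zero))
  wq≤ outside = ≤-refl
  head : ∀ t s → (∀ {x} → x ∈ t ∷ p → x ∈ s ∷ q ⊎ b * g x ≤ c) →
         b * weight g (t ∷ p) ≤ b * weight g (s ∷ q) + ∣ t ∷ p ∣ * c
  head outside s _ = ≤-trans tail (+-monoˡ-≤ _ (wq≤ s))
  head inside s small with small here
  head inside .inside _ | inj₁ here = begin
    b * (g zero + w p)                    ≡⟨ *-distribˡ-+ b (g zero) (w p) ⟩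
    b * g zero + b * w p                  ≤⟨ +-monoʳ-≤ (b * g zero) tail ⟩
    b * g zero + (b * w q + ∣ p ∣ * c)    ≡⟨ +-assoc (b * g zero) (b * w q) _ ⟨
    b * g zero + b * w q + ∣ p ∣ * c      ≡⟨ cong (_+ ∣ p ∣ * c) (*-distribˡ-+ b (g zero) (w q)) ⟨
    b * (g zero + w q) + ∣ p ∣ * c        ≤⟨ +-monoʳ-≤ (b * (g zero + w q)) (m≤n+m _ c) ⟩
    b * (g zero + w q) + (c + ∣ p ∣ * c)  ∎
  head inside s _ | inj₂ g₀-small = begin
    b * (g zero + w p)                      ≡⟨ *-distribˡ-+ b (g zero) (w p) ⟩
    b * g zero + b * w p                    ≤⟨ +-mono-≤ g₀-small tail ⟩
    c + (b * w q + ∣ p ∣ * c)               ≡⟨ x∙yz≈y∙xz +-commutativeSemigroup c (b * w q) _ ⟩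
    b * w q + (c + ∣ p ∣ * c)               ≤⟨ +-monoˡ-≤ _ (wq≤ s) ⟩
    b * weight g (s ∷ q) + (c + ∣ p ∣ * c)  ∎

-- The number of subsets satisfying `P`; applied to faces, it is the measure by which reductions
-- terminate.
#_ : {P : Pred (Subset N) 0ℓ} → Decidable P → ℕ
#_ {zero}  P? = if does (P? []) then 1 else 0
#_ {suc N} P? = # (P? ∘ (inside ∷_)) + # (P? ∘ (outside ∷_))

#-mono : {P Q : Pred (Subset N) 0ℓ} (P? : Decidable P) (Q? : Decidable Q) →
         (∀ {p} → P p → Q p) → # P? ≤ # Q?
#-mono {zero} P? Q? P⊆Q with P? [] | Q? []
... | no _  | _     = z≤n
... | yes _ | yes _ = ≤-refl
... | yes P | no ¬Q = ⊥-elim (¬Q (P⊆Q P))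
#-mono {suc N} P? Q? P⊆Q = +-mono-≤
  (#-mono (P? ∘ (inside ∷_)) (Q? ∘ (inside ∷_)) P⊆Q)
  (#-mono (P? ∘ (outside ∷_)) (Q? ∘ (outside ∷_)) P⊆Q)

#-mono-< : {P Q : Pred (Subset N) 0ℓ} (P? : Decidable P) (Q? : Decidable Q) →
           (∀ {p} → P p → Q p) → ∀ p → Q p → ¬ P p → # P? < # Q?
#-mono-< {zero} P? Q? P⊆Q [] Qp ¬Pp with P? [] | Q? []
... | no _  | yes _ = ≤-refl
... | no _  | no ¬Q = ⊥-elim (¬Q Qp)
... | yes P | _     = ⊥-elim (¬Pp P)
#-mono-< {suc N} P? Q? P⊆Q (inside ∷ p) Qp ¬Pp =
  +-mono-<-≤
  (#-mono-< (P? ∘ (inside ∷_)) (Q? ∘ (inside ∷_)) P⊆Q p Qp ¬Pp)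
  (#-mono (P? ∘ (outside ∷_)) (Q? ∘ (outside ∷_)) P⊆Q)
#-mono-< {suc N} P? Q? P⊆Q (outside ∷ p) Qp ¬Pp =
  +-mono-≤-<
  (#-mono (P? ∘ (inside ∷_)) (Q? ∘ (inside ∷_)) P⊆Q)
  (#-mono-< (P? ∘ (outside ∷_)) (Q? ∘ (outside ∷_)) P⊆Q p Qp ¬Pp)

-- Vertices and facets of a complex.

module _ {P : Pred (Fin N) 0ℓ} (P? : Decidable P) where

  ∈-tabulate⁺ : ∀ {x} → P x → x ∈ tabulate (does ∘ P?)
  ∈-tabulate⁺ {x} Px =
    lookup⇒[]= x _ (trans (lookup∘tabulate (does ∘ P?) x) (dec-true (P? x) Px))

  ∈-tabulate⁻ : ∀ {x} → x ∈ tabulate (does ∘ P?) → P x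
  ∈-tabulate⁻ {x} x∈ with P? x | trans (sym (lookup∘tabulate (does ∘ P?) x)) ([]=⇒lookup x∈)
  ... | yes Px | _  = Px
  ... | no _   | ()

module _ (Γ : SimplicialComplex N) where

  ∈-vertices⁺ : ∀ {v} → Face Γ ⁅ v ⁆ → v ∈ vertices Γ
  ∈-vertices⁺ = ∈-tabulate⁺ (Face? Γ ∘ ⁅_⁆)

  ∈-vertices⁻ : ∀ {v} → v ∈ vertices Γ → Face Γ ⁅ v ⁆
  ∈-vertices⁻ = ∈-tabulate⁻ (Face? Γ ∘ ⁅_⁆)

  x∈face⇒vertex : ∀ {F v} → Face Γ F → v ∈ F → v ∈ vertices Γ
  x∈face⇒vertex F∈Γ v∈F = ∈-vertices⁺ (downClosed Γ (⁅x⁆⊆p v∈F) F∈Γ)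

  face⊆facet : ∀ {F} → Face Γ F → ∃[ G ] IsFacet Γ G × F ⊆ G
  face⊆facet {F} F∈Γ
    with G , (G∈Γ , F⊆G) , maximal ← maximise anySubset? (λ G → Face? Γ G ×-dec F ⊆? G)
           ∣_∣ N (λ G _ → ∣p∣≤n G) (F , F∈Γ , id)
    = G , (G∈Γ , λ (K , K∈Γ , G⊂K) →
        <⇒≱ (p⊂q⇒∣p∣<∣q∣ G⊂K) (maximal K (K∈Γ , ⊆-trans F⊆G (p⊂q⇒p⊆q G⊂K)))) , F⊆G

  facet-≡ : ∀ {F G} → IsFacet Γ F → Face Γ G → F ⊆ G → F ≡ G
  facet-≡ {F} {G} (_ , maximal) G∈Γ F⊆G =
    ⊆-antisym F⊆G λ {x} x∈G → decidable-stable (x ∈? F) λ x∉F →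
      maximal (G , G∈Γ , F⊆G , x , x∈G , x∉F)

  maxDim⇒facet : ∀ {d F} → DimAtMost d Γ → Face Γ F → ∣ F ∣ ≡ suc d → IsFacet Γ F
  maxDim⇒facet dim F∈Γ F≡ = F∈Γ , λ (G , G∈Γ , F⊂G) →
    <⇒≱ (p⊂q⇒∣p∣<∣q∣ F⊂G) (subst (∣ G ∣ ≤_) (sym F≡) (dim G G∈Γ))

-- Labelings as injective numberings.

Top : (Fin N → ℕ) → Subset N → Fin N → Set
Top κ F v = v ∈ F × (∀ {x} → x ∈ F → κ x ≤ κ v)

∃-top : (κ : Fin N → ℕ) {F : Subset N} → Nonempty F → ∃[ v ] Top κ F v
∃-top κ {F} nonempty
  with v , v∈F , top ← maximise Fin.any? (_∈? F) κ (weight κ F) (λ _ → x∈p⇒g[x]≤weight κ) nonempty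
  = v , v∈F , λ {x} → top x

-- Labels may be any distinct numbers: only their order on the vertices matters.
EChordalBy : (Fin N → ℕ) → SimplicialComplex N → Set
EChordalBy κ Δ = ∀ {F G v} → IsFacet Δ F → IsFacet Δ G → F ≢ G → ∣ F ∣ ≡ ∣ G ∣ →
  Top κ F v → Top κ G v → ∀ {H} → H ⊆ F ∪ G → ∣ H ∣ ≡ ∣ F ∣ → Face Δ H

Inj : (Fin N → ℕ) → Set
Inj = Injective _≡_ _≡_

module _ (Δ : SimplicialComplex N) where

  eChordal⇒eChordalBy : EChordal Δ → ∃[ κ ] Inj κ × EChordalBy κ Δ
  eChordal⇒eChordalBy (ℓ , chordal) = κ , κ-injective , chordalBy
    where
    open Bijection ℓ using (injective) renaming (to to label)
    κ : Fin N → ℕ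
    κ v with v ∈? vertices Δ
    ... | yes v∈ = toℕ (label (v , v∈))
    -- Vertex labels are below `∣ vertices Δ ∣ ≤ N`, so the shift by `N` keeps `κ` injective on all
    -- of `Fin N`.
    ... | no _   = N + toℕ v
    κ≡label : ∀ {v} v∈ → κ v ≡ toℕ (label (v , v∈))
    κ≡label {v} v∈ with v ∈? vertices Δ
    ... | yes v∈′ = cong (λ p → toℕ (label (v , p))) ([]=-irrelevant v∈′ v∈)
    ... | no v∉   = ⊥-elim (v∉ v∈)
    label<N : ∀ v → toℕ (label v) < N
    label<N v = ≤-trans (Fin.toℕ<n (label v)) (∣p∣≤n (vertices Δ))
    κ-injective : Inj κ
    κ-injective {v} {w} eq with v ∈? vertices Δ | w ∈? vertices Δ
    ... | yes v∈ | yes w∈ = cong proj₁ (injective (Fin.toℕ-injective eq))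
    ... | yes v∈ | no _   = ⊥-elim (<⇒≢ (≤-trans (label<N (v , v∈)) (m≤m+n N _)) eq)
    ... | no _   | yes w∈ = ⊥-elim (<⇒≢ (≤-trans (label<N (w , w∈)) (m≤m+n N _)) (sym eq))
    ... | no _   | no _   = Fin.toℕ-injective (+-cancelˡ-≡ N _ _ eq)
    isMax : ∀ {F v} (v∈ : v ∈ vertices Δ) → Top κ F v → IsMax Δ ℓ F (label (v , v∈))
    isMax v∈ (v∈F , top) = ((_ , v∈) , v∈F , refl) , λ (x , x∈) x∈F →
      subst₂ _≤_ (κ≡label x∈) (κ≡label v∈) (top x∈F)
    chordalBy : EChordalBy κ Δ
    chordalBy {F} {G} Ff Gf F≢G F≡G topF topG =
      chordal F G Ff Gf F≢G F≡G (_ , isMax v∈ topF , isMax v∈ topG) _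
      where v∈ = x∈face⇒vertex Δ (proj₁ Ff) (proj₁ topF)

nth : (p : Subset N) → Fin ∣ p ∣ → Fin N
nth (inside  ∷ p) zero    = zero
nth (inside  ∷ p) (suc i) = suc (nth p i)
nth (outside ∷ p) i       = suc (nth p i)

nth∈ : (p : Subset N) (i : Fin ∣ p ∣) → nth p i ∈ p
nth∈ (inside  ∷ p) zero    = here
nth∈ (inside  ∷ p) (suc i) = there (nth∈ p i)
nth∈ (outside ∷ p) i       = there (nth∈ p i)

nth-injective : (p : Subset N) → Injective _≡_ _≡_ (nth p)
nth-injective (inside  ∷ p) {zero}  {zero}  _  = refl
nth-injective (inside  ∷ p) {suc i} {suc j} eq = cong suc (nth-injective p (Fin.suc-injective eq))
nth-injective (outside ∷ p) eq = nth-injective p (Fin.suc-injective eq)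

injective⇒surjective : {f : Fin n → Fin n} → Injective _≡_ _≡_ f → ∀ y → ∃[ x ] f x ≡ y
injective⇒surjective {suc n} {f} inj y with Fin.any? (λ x → f x Fin.≟ y)
... | yes found = found
-- Punching out a missed value `y` would give an injection from `Fin (suc n)` to `Fin n`.
... | no none   = ⊥-elim (1+n≰n (Fin.injective⇒≤ {f = λ x → punchOut (y≢f x)}
        λ eq → inj (Fin.punchOut-injective (y≢f _) (y≢f _) eq)))
  where
  y≢f : ∀ x → y ≢ f x
  y≢f x y≡ = none (x , sym y≡)

module _ (Δ : SimplicialComplex N) {κ : Fin N → ℕ} (κ-injective : Inj κ) where

  private
    V = vertices Δ

    Below? : ∀ v → Decidable (λ x → x ∈ V × κ x < κ v)
    Below? v x = x ∈? V ×-dec κ x <? κ v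

    below : Fin N → Subset N
    below v = tabulate (does ∘ Below? v)

    -- Ranks compress the values of `κ` on the vertices to an initial segment without changing their
    -- order. Surjectivity of the resulting labels then follows by counting.
    rank : Fin N → ℕ
    rank v = ∣ below v ∣

    rank<∣V∣ : ∀ {v} → v ∈ V → rank v < ∣ V ∣
    rank<∣V∣ {v} v∈ = p⊂q⇒∣p∣<∣q∣
      ( (λ x∈ → proj₁ (∈-tabulate⁻ (Below? v) x∈))
      , v , v∈ , λ v∈′ → <-irrefl refl (proj₂ (∈-tabulate⁻ (Below? v) v∈′)))

    rank-mono-< : ∀ {v w} → v ∈ V → κ v < κ w → rank v < rank w
    rank-mono-< {v} {w} v∈ v<w = p⊂q⇒∣p∣<∣q∣
      ( (λ x∈ → ∈-tabulate⁺ (Below? w) (map₂ (λ x<v → <-trans x<v v<w) (∈-tabulate⁻ (Below? v) x∈)))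
      , v , ∈-tabulate⁺ (Below? w) (v∈ , v<w)
      , λ v∈′ → <-irrefl refl (proj₂ (∈-tabulate⁻ (Below? v) v∈′)))

    rank-cancel-≤ : ∀ {v w} → w ∈ V → rank v ≤ rank w → κ v ≤ κ w
    rank-cancel-≤ w∈ v≤w = ≮⇒≥ λ w<v → <⇒≱ (rank-mono-< w∈ w<v) v≤w

    label : Vertex Δ → Fin ∣ V ∣
    label (v , v∈) = fromℕ< (rank<∣V∣ v∈)

    label-cancel-≤ : ∀ v w → label v Fin.≤ label w → κ (proj₁ v) ≤ κ (proj₁ w)
    label-cancel-≤ (v , v∈) (w , w∈) v≤w = rank-cancel-≤ w∈
      (subst₂ _≤_ (Fin.toℕ-fromℕ< (rank<∣V∣ v∈)) (Fin.toℕ-fromℕ< (rank<∣V∣ w∈)) v≤w)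

    label-injective : Injective _≡_ _≡_ label
    label-injective {v , v∈} {w , w∈} eq
      with refl ← κ-injective (≤-antisym
                    (label-cancel-≤ (v , v∈) (w , w∈) (≤-reflexive (cong toℕ eq)))
                    (label-cancel-≤ (w , w∈) (v , v∈) (≤-reflexive (cong toℕ (sym eq)))))
      = cong (v ,_) ([]=-irrelevant v∈ w∈)

    vertex : Fin ∣ V ∣ → Vertex Δ
    vertex i = nth V i , nth∈ V i

    labeling : Labeling Δ
    labeling = mk⤖ (label-injective , λ y →
      let i , eq = injective⇒surjective {f = label ∘ vertex}
           (λ eq → nth-injective V (cong proj₁ (label-injective {vertex _} {vertex _} eq))) y
      in vertex i , λ { refl → eq })

  eChordalBy⇒eChordal : EChordalBy κ Δ → EChordal Δ
  eChordalBy⇒eChordal chordal = labeling , λ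
    { F G Ff Gf F≢G F≡G (m , ((v , v∈F , v≡m) , maxF) , ((w , w∈G , w≡m) , maxG)) H H⊆ H≡ →
      chordal Ff Gf F≢G F≡G (top Ff v v∈F v≡m maxF)
        (subst (Top κ G ∘ proj₁) (label-injective {w} {v} (trans w≡m (sym v≡m))) (top Gf w w∈G w≡m maxG))
        H⊆ H≡ }
    where
    top : ∀ {F m} → IsFacet Δ F → ∀ v → proj₁ v ∈ F → label v ≡ m →
          (∀ x → proj₁ x ∈ F → label x Fin.≤ m) → Top κ F (proj₁ v)
    top (F∈Δ , _) v v∈F refl maxF = v∈F , λ x∈F →
      let x∈V = x∈face⇒vertex Δ F∈Δ x∈F in label-cancel-≤ (_ , x∈V) v (maxF (_ , x∈V) x∈F)

_≟ˢ_ : (p q : Subset N) → Dec (p ≡ q)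
_≟ˢ_ = ≡-dec Bool._≟_

-- Deletion above a face.

module _ (Γ : SimplicialComplex N) where

  abdel-⊆ : ∀ {R F} → Face (abdel R Γ) F → Face Γ F
  abdel-⊆ (_ , ((G∈Γ , _) , _) , F⊆G) = downClosed Γ F⊆G G∈Γ

  abdel-⊈ : ∀ {R F} → Face (abdel R Γ) F → R ⊈ F
  abdel-⊈ (_ , (_ , R⊈G) , F⊆G) R⊆F = R⊈G (⊆-trans R⊆F F⊆G)

  facet∈abdel : ∀ {R F} → IsFacet Γ F → R ⊈ F → Face (abdel R Γ) F
  facet∈abdel {F = F} Ff R⊈F = F , (Ff , R⊈F) , id

  facet-abdel : ∀ {R F} → IsFacet Γ F → R ⊈ F → IsFacet (abdel R Γ) F
  facet-abdel Ff R⊈F = facet∈abdel Ff R⊈F , λ (G , G∈ , F⊂G) → proj₂ Ff (G , abdel-⊆ G∈ , F⊂G)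

  -- A face avoiding `R` may still vanish if all facets around it contain `R`; a face of top
  -- dimension is its own facet and cannot.
  maxDim⇒∈abdel : ∀ {d R F} → DimAtMost d Γ → Face Γ F → ∣ F ∣ ≡ suc d → R ⊈ F → Face (abdel R Γ) F
  maxDim⇒∈abdel dim F∈Γ F≡ = facet∈abdel (maxDim⇒facet Γ dim F∈Γ F≡)

-- Vertex-chordal complexes are E-chordal.

-- The new vertex of an elimination step is put on top of the labels of the others.
eliminationLabels : ∀ {d} {Γ Γ′ : SimplicialComplex N} → Star (0 , d ⊢_⟶_) Γ Γ′ → DimAtMost 0 Γ′ →
  ∃[ κ ] Inj κ × (∃[ b ] (∀ x → κ x < b)) ×
  (∀ {F G v} → IsFacet Γ F → IsFacet Γ G → F ≢ G → Top κ F v → Top κ G v →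
   ∀ {k H} → k ≤ d → H ⊆ F ∪ G → ∣ H ∣ ≡ suc k → Face Γ H)
eliminationLabels {N} ε dim = toℕ , Fin.toℕ-injective , (N , Fin.toℕ<n) ,
  λ {F} {G} (F∈ , _) (G∈ , _) F≢G (v∈F , _) (v∈G , _) _ _ _ →
    -- Facets with at most one vertex that share `v` are both `⁅ v ⁆`.
    ⊥-elim (F≢G (trans (∣p∣≤1⇒p≡⁅x⁆ (dim F F∈) v∈F) (sym (∣p∣≤1⇒p≡⁅x⁆ (dim G G∈) v∈G))))
eliminationLabels {N} {d} {Γ} (delete S ∣S∣≡1 (_ , _ , clique) ◅ rest) dim
  with u , u∈S ← 0<∣p∣⇒Nonempty (subst (0 <_) (sym ∣S∣≡1) 0<1+n)
  with refl ← ∣p∣≤1⇒p≡⁅x⁆ {p = S} (≤-reflexive ∣S∣≡1) u∈S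
  with κ , κ-injective , (b , κ<b) , chordal ← eliminationLabels rest dim
  = κ′ , κ′-injective , (suc b , κ′<1+b) , chordal′
  where
  κ′ : Fin N → ℕ
  κ′ x with x Fin.≟ u
  -- `b` lies strictly above all values of `κ`, so `u` receives the largest label.
  ... | yes _ = b
  ... | no _  = κ x
  κ′-injective : Inj κ′
  κ′-injective {x} {y} eq with x Fin.≟ u | y Fin.≟ u
  ... | yes refl | yes refl = refl
  ... | yes _    | no _     = ⊥-elim (<⇒≢ (κ<b y) (sym eq))
  ... | no _     | yes _    = ⊥-elim (<⇒≢ (κ<b x) eq)
  ... | no _     | no _     = κ-injective eq
  κ′<1+b : ∀ x → κ′ x < suc b
  κ′<1+b x with x Fin.≟ u
  ... | yes _ = ≤-refl
  ... | no _  = m≤n⇒m≤1+n (κ<b x)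
  κ′u≡b : κ′ u ≡ b
  κ′u≡b with u Fin.≟ u
  ... | yes _  = refl
  ... | no u≢u = ⊥-elim (u≢u refl)
  κ′≡κ : ∀ {x} → x ≢ u → κ′ x ≡ κ x
  κ′≡κ {x} x≢u with x Fin.≟ u
  ... | yes x≡u = ⊥-elim (x≢u x≡u)
  ... | no _    = refl
  top≡u : ∀ {F v} → Top κ′ F v → u ∈ F → v ≡ u
  top≡u {v = v} (_ , top) u∈F = κ′-injective
    (≤-antisym (≤-trans (s≤s⁻¹ (κ′<1+b v)) (≤-reflexive (sym κ′u≡b))) (top u∈F))
  top-κ : ∀ {F v} → u ∉ F → Top κ′ F v → Top κ F v
  top-κ {F} u∉F (v∈F , top) = v∈F , λ x∈F → subst₂ _≤_ (κ′≡κ (≢u x∈F)) (κ′≡κ (≢u v∈F)) (top x∈F)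
    where
    ≢u : ∀ {x} → x ∈ F → x ≢ u
    ≢u x∈F refl = u∉F x∈F
  chordal′ : ∀ {F G v} → IsFacet Γ F → IsFacet Γ G → F ≢ G → Top κ′ F v → Top κ′ G v →
             ∀ {k H} → k ≤ d → H ⊆ F ∪ G → ∣ H ∣ ≡ suc k → Face Γ H
  chordal′ {F} {G} Ff Gf F≢G topF topG {k} {H} k≤d H⊆F∪G ∣H∣≡ with u ∈? F | u ∈? G
  -- Both facets lie in the star of `u`, whose vertices form a clique; their sizes do not matter.
  ... | yes u∈F | yes u∈G = clique k k≤d H (⊆-trans H⊆F∪G (∪-⊆ (nbrs Ff u∈F) (nbrs Gf u∈G))) ∣H∣≡
    where
    nbrs : ∀ {F} → IsFacet Γ F → u ∈ F → F ⊆ vertices (star ⁅ u ⁆ Γ)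
    nbrs (F∈Γ , _) u∈F x∈F =
      ∈-vertices⁺ (star ⁅ u ⁆ Γ) (downClosed Γ (∪-⊆ (⁅x⁆⊆p u∈F) (⁅x⁆⊆p x∈F)) F∈Γ)
  -- The common top would be `u`, which only one of the facets contains.
  ... | yes u∈F | no u∉G = ⊥-elim (u∉G (subst (_∈ G) (top≡u topF u∈F) (proj₁ topG)))
  ... | no u∉F | yes u∈G = ⊥-elim (u∉F (subst (_∈ F) (top≡u topG u∈G) (proj₁ topF)))
  -- Both facets survive the deletion as facets, so the labels of the smaller complex apply.
  ... | no u∉F | no u∉G = abdel-⊆ Γ
    (chordal (facet-abdel Γ Ff (avoid u∉F)) (facet-abdel Γ Gf (avoid u∉G)) F≢G
             (top-κ u∉F topF) (top-κ u∉G topG) k≤d H⊆F∪G ∣H∣≡)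
    where
    avoid : ∀ {F} → u ∉ F → ⁅ u ⁆ ⊈ F
    avoid u∉F u⊆F = u∉F (u⊆F (x∈⁅x⁆ u))

vertexChordal⇒eChordal : (Δ : SimplicialComplex N) → VertexChordal Δ → EChordal Δ
vertexChordal⇒eChordal Δ (d , (dim , _) , _ , Γ , steps , dimΓ)
  with κ , κ-injective , _ , chordal ← eliminationLabels steps dimΓ
  = eChordalBy⇒eChordal Δ κ-injective chordalBy
  where
  chordalBy : EChordalBy κ Δ
  chordalBy {F} Ff Gf F≢G F≡G topF topG H⊆ H≡F =
    chordal Ff Gf F≢G topF topG (s≤s⁻¹ (subst (_≤ suc d) (sym 1+k≡) (dim F (proj₁ Ff)))) H⊆
      (trans H≡F (sym 1+k≡))
    where
    1+k≡ = ∣p-x∣ (proj₁ topF)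

-- Top-dimensional faces with a common maximum.

TopFacet : SimplicialComplex N → ℕ → (Fin N → ℕ) → Fin N → Pred (Subset N) 0ℓ
TopFacet Δ d κ v A = Face Δ A × ∣ A ∣ ≡ suc d × Top κ A v

module _ (Δ : SimplicialComplex N) {d : ℕ} (dim : DimAtMost d Δ)
         {κ : Fin N → ℕ} (chordal : EChordalBy κ Δ) {v : Fin N} where

  private
    exchange : ∀ {A B} → TopFacet Δ d κ v A → TopFacet Δ d κ v B →
               ∀ {H} → H ⊆ A ∪ B → ∣ H ∣ ≡ suc d → Face Δ H
    exchange {A} {B} (A∈Δ , A≡ , topA) (B∈Δ , B≡ , topB) {H} H⊆ H≡ with A ≟ˢ B
    ... | yes refl = downClosed Δ (⊆-trans H⊆ (∪-⊆ id id)) A∈Δ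
    ... | no A≢B = chordal (maxDim⇒facet Δ dim A∈Δ A≡) (maxDim⇒facet Δ dim B∈Δ B≡) A≢B
                     (trans A≡ (sym B≡)) topA topB H⊆ (trans H≡ (sym A≡))

  module _ {W : Subset N} (cover : ∀ {w} → w ∈ W → ∃[ A ] TopFacet Δ d κ v A × w ∈ A) where

    private
      -- A set S ⊆ W grows one vertex at a time inside a face with top v: if A ⊇ S - x and
      -- B ∋ x, then S ∪ {v} ⊆ A ∪ B extends to a (d+1)-set, which is a face by exchange.
      absorb : ∃[ A ] TopFacet Δ d κ v A → ∀ n S → ∣ S ∣ ≡ n → S ⊆ W → ∣ S ∪ ⁅ v ⁆ ∣ ≤ suc d →
               ∃[ A ] TopFacet Δ d κ v A × S ⊆ A
      absorb (A , topA) zero S S≡ _ _ =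
        A , topA , λ x∈S → ⊥-elim (<⇒≢ (x∈p⇒0<∣p∣ x∈S) (sym S≡))
      absorb ∃A (suc n) S S≡ S⊆W S≤ =
        let x , x∈S = 0<∣p∣⇒Nonempty (subst (0 <_) (sym S≡) 0<1+n)
            S-x⊆S = p─q⊆p S ⁅ x ⁆
            A , topA@(A∈Δ , A≡ , v∈A , maxA) , S-x⊆A =
              absorb ∃A n (S - x) (suc-injective (trans (∣p-x∣ x∈S) S≡)) (⊆-trans S-x⊆S S⊆W)
                (≤-trans (p⊆q⇒∣p∣≤∣q∣ (∪-⊆ (⊆-trans S-x⊆S (p⊆p∪q _)) (q⊆p∪q S _))) S≤)
            B , topB@(_ , _ , v∈B , maxB) , x∈B = cover (S⊆W x∈S)
            S⊆A∪B : S ⊆ A ∪ B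
            S⊆A∪B = subst (_⊆ A ∪ B) (p-x∪⁅x⁆≡p x∈S)
              (∪-⊆ (⊆-trans S-x⊆A (p⊆p∪q B)) (⁅x⁆⊆p (q⊆p∪q A B x∈B)))
            C , Sv⊆C , C⊆A∪B , C≡ = ∃-between (∪-⊆ S⊆A∪B (⁅x⁆⊆p (p⊆p∪q B v∈A))) S≤
              (subst (_≤ ∣ A ∪ B ∣) A≡ (∣p∣≤∣p∪q∣ A B))
        in C , (exchange topA topB C⊆A∪B C≡ , C≡ , Sv⊆C (y∈p∪⁅y⁆ S) ,
                λ y∈C → [ maxA , maxB ]′ (x∈p∪q⁻ A B (C⊆A∪B y∈C))) ,
           ⊆-trans (p⊆p∪q _) Sv⊆C

    -- `absorb` reaches only sets that fit into a d-face together with `v`, so it is applied to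
    -- `H - x`. With `A ⊇ H - x` and `B ∋ x`, one more exchange covers `H`, whether or not `v ∈ H`.
    topFacets-complete : ∀ {H} → H ⊆ W → ∣ H ∣ ≡ suc d → Face Δ H
    topFacets-complete {H} H⊆W H≡ =
      let x , x∈H = 0<∣p∣⇒Nonempty (subst (0 <_) (sym H≡) 0<1+n)
          B , topB , x∈B = cover (H⊆W x∈H)
          A , topA , H-x⊆A = absorb (B , topB) _ (H - x) refl (⊆-trans (p─q⊆p H _) H⊆W) (size x∈H)
      in exchange topA topB (subst (_⊆ A ∪ B) (p-x∪⁅x⁆≡p x∈H)
           (∪-⊆ (⊆-trans H-x⊆A (p⊆p∪q B)) (⁅x⁆⊆p (q⊆p∪q A B x∈B)))) H≡
      where
      size : ∀ {x} → x ∈ H → ∣ (H - x) ∪ ⁅ v ⁆ ∣ ≤ suc d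
      size {x} x∈H with v ∈? (H - x)
      ... | yes v∈ = ≤-trans
        (p⊆q⇒∣p∣≤∣q∣ (∪-⊆ (p─q⊆p H ⁅ x ⁆) (⁅x⁆⊆p (p─q⊆p H _ v∈)))) (≤-reflexive H≡)
      ... | no v∉  = ≤-reflexive (trans (∣p∪⁅x⁆∣ (H - x) v∉) (trans (∣p-x∣ x∈H) H≡))

-- A clique criterion and termination of reductions.

-- Since `X` has at least `suc d` elements, every smaller subset extends within `X` to one of size
-- `suc d`.
isClique⁺ : (Γ : SimplicialComplex N) {d : ℕ} {X : Subset N} → suc d ≤ ∣ X ∣ →
            (∀ {H} → H ⊆ X → ∣ H ∣ ≡ suc d → Face Γ H) → IsClique d Γ X
isClique⁺ Γ {d} {X} d<X full =
  (λ {x} x∈X → ∈-vertices⁺ Γ (clique 0 z≤n ⁅ x ⁆ (⁅x⁆⊆p x∈X) (∣⁅x⁆∣≡1 x))) , clique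
  where
  clique : ∀ k → k ≤ d → ∀ Y → Y ⊆ X → ∣ Y ∣ ≡ suc k → Face Γ Y
  clique k k≤d Y Y⊆X Y≡ =
    let H , Y⊆H , H⊆X , H≡ = ∃-between Y⊆X (≤-trans (≤-reflexive Y≡) (s≤s k≤d)) d<X
    in downClosed Γ Y⊆H (full H⊆X H≡)

module _ {j d : ℕ} (Inv : Pred (SimplicialComplex N) 0ℓ)
         (step : ∀ {Γ} → Inv Γ → DimAtMost j Γ ⊎ ∃[ Γ′ ] (j , d ⊢ Γ ⟶ Γ′) × Inv Γ′) where

  private
    Goal : ℕ → Set₁
    Goal n = ∀ {Γ} → # (Face? Γ) ≡ n → Inv Γ → ∃[ Γ′ ] Star (j , d ⊢_⟶_) Γ Γ′ × DimAtMost j Γ′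

    descend : ∀ n → (∀ {m} → m < n → Goal m) → Goal n
    descend _ rec {Γ} refl inv with step inv
    ... | inj₁ dim = Γ , ε , dim
    ... | inj₂ (_ , s@(delete F _ (F∈Γ , _)) , inv′) =
      let Γ″ , steps , dim = rec (#-mono-< (Face? (abdel F Γ)) (Face? Γ) (abdel-⊆ Γ) F F∈Γ
                                  λ F∈ → abdel-⊈ Γ F∈ id) refl inv′
      in Γ″ , s ◅ steps , dim

  -- A deletion creates no faces and destroys at least the face `F` above which it deletes, so the
  -- number of faces drops.
  reduce : ∀ {Γ} → Inv Γ → ∃[ Γ′ ] Star (j , d ⊢_⟶_) Γ Γ′ × DimAtMost j Γ′
  reduce = <-rec Goal descend _ refl

-- Smallest vertices and lexicographic weights.

module _ (κ : Fin N → ℕ) where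

  infix 4 _≪_
  _≪_ : Fin N → Subset N → Set
  a ≪ R = ∀ {x} → x ∈ R → κ a < κ x

  ≪⇒∉ : ∀ {a R} → a ≪ R → a ∉ R
  ≪⇒∉ a≪R a∈R = <-irrefl refl (a≪R a∈R)

  ≪? : ∀ a R → Dec (a ≪ R)
  ≪? a R = map′ (λ all {x} → all x) (λ a≪R x → a≪R)
             (Fin.all? λ x → x ∈? R →-dec κ a <? κ x)

  split-min : Inj κ → ∀ {m} F → ∣ F ∣ ≡ suc m → ∃[ R ] ∃[ a ] ∣ R ∣ ≡ m × a ≪ R × R ∪ ⁅ a ⁆ ≡ F
  split-min κ-injective F F≡ =
    let a , a∈F , minimal =
          minimise Fin.any? (_∈? F) κ (0<∣p∣⇒Nonempty (subst (0 <_) (sym F≡) 0<1+n))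
    in F - a , a , suc-injective (trans (∣p-x∣ a∈F) F≡) ,
       (λ {x} x∈ → ≤∧≢⇒< (minimal x (p─q⊆p F _ x∈))
         λ eq → x∉p-x F (subst (_∈ F - a) (sym (κ-injective eq)) x∈)) ,
       p-x∪⁅x⁆≡p a∈F

  -- Base 1 + N makes the comparison of weights lexicographic from the largest label down.
  wt : Subset N → ℕ
  wt = weight λ x → suc N ^ κ x

  -- Each element of `S` outside `R - u` has `κ`-value below `κ u`, so `suc N` times its weight is
  -- at most that of `u`. There are at most `N` of them, too few to make up `suc N` copies of `u`.
  wt-< : ∀ {R S u} → u ∈ R → u ∉ S → (∀ {x} → x ∈ S → x ∈ R ⊎ κ x < κ u) → wt S < wt R
  wt-< {R} {S} {u} u∈R u∉S S⊆ = *-cancelˡ-< (suc N) _ _ (begin-strict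
    suc N * wt S                            ≤⟨ weight-≤ _ (suc N) (g u) S (R - u) small ⟩
    suc N * wt (R - u) + ∣ S ∣ * g u         <⟨ +-monoʳ-< _ (*-monoˡ-< (g u) (s≤s (∣p∣≤n S))) ⟩
    suc N * wt (R - u) + suc N * g u         ≡⟨ *-distribˡ-+ (suc N) (wt (R - u)) (g u) ⟨
    suc N * (wt (R - u) + g u)               ≡⟨ cong (suc N *_) (+-comm (wt (R - u)) (g u)) ⟩
    suc N * (g u + wt (R - u))               ≡⟨ cong (suc N *_) (weight-split g u∈R) ⟨
    suc N * wt R                            ∎)
    where
    open ≤-Reasoning
    g : Fin N → ℕ
    g x = suc N ^ κ x
    instance
      g≢0 = m^n≢0 (suc N) (κ u)
    small : ∀ {x} → x ∈ S → x ∈ R - u ⊎ suc N * g x ≤ g u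
    small x∈S with S⊆ x∈S
    ... | inj₁ x∈R = inj₁ (x∈p∧x≢y⇒x∈p-y x∈R λ { refl → u∉S x∈S })
    ... | inj₂ x<u = inj₂ (^-monoʳ-≤ (suc N) x<u)

-- E-chordal complexes are ridge-chordal.

module _ (Δ : SimplicialComplex N) {j : ℕ} (dim : DimAtMost (suc j) Δ)
         (κ : Fin N → ℕ) (κ-injective : Inj κ) (chordal : EChordalBy κ Δ) where

  private
    d = suc j

    _<<_ = _≪_ κ
    w : Subset N → ℕ
    w = wt κ

    -- Each d-face arises from exactly one such pair, `a` being its smallest vertex; this assigns it
    -- a single ridge.
    Ridge : SimplicialComplex N → Subset N → Fin N → Set
    Ridge Γ R a = ∣ R ∣ ≡ d × a << R × Face Γ (R ∪ ⁅ a ⁆)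

    -- The ridges have been deleted in order of decreasing weight, each with all its d-faces.
    Inv : SimplicialComplex N → Set
    Inv Γ = (∀ {F} → Face Γ F → Face Δ F)
          × (∀ {R a S b} → Ridge Γ R a → Ridge Δ S b → ¬ Face Γ (S ∪ ⁅ b ⁆) → w R ≤ w S × R ≢ S)

    Ridge? : ∀ Γ R → Dec (∃ (Ridge Γ R))
    Ridge? Γ R = Fin.any? λ a → ∣ R ∣ ≟ d ×-dec ≪? κ a R ×-dec Face? Γ (R ∪ ⁅ a ⁆)

    module _ (Γ : SimplicialComplex N) (inv : Inv Γ) {R a} (ridge : Ridge Γ R a)
             (maximal : ∀ {S b} → Ridge Γ S b → w S ≤ w R) where

      ∣R∣≡d = proj₁ ridge
      a≪R = proj₁ (proj₂ ridge)
      R∪a∈Γ = proj₂ (proj₂ ridge)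

      dimΓ : DimAtMost d Γ
      dimΓ F F∈Γ = dim F (proj₁ inv F∈Γ)

      ∣R∪x∣ : ∀ {x} → x ∉ R → ∣ R ∪ ⁅ x ⁆ ∣ ≡ suc d
      ∣R∪x∣ x∉R = trans (∣p∪⁅x⁆∣ R x∉R) (cong suc ∣R∣≡d)

      -- Otherwise the smallest vertex `b` of `R ∪ ⁅ x ⁆` lies in `R`, and trading `b` for the
      -- larger `x` gives a heavier ridge, against the maximality of `R`.
      nbr≪R : ∀ {x} → x ∉ R → Face Γ (R ∪ ⁅ x ⁆) → x << R
      nbr≪R {x} x∉R Rx∈Γ with split-min κ κ-injective (R ∪ ⁅ x ⁆) (∣R∪x∣ x∉R)
      ... | S , b , S≡ , b≪S , Sb≡Rx with b Fin.≟ x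
      ... | yes refl = λ y∈R → b≪S ([ id , (λ { refl → ⊥-elim (x∉R y∈R) }) ]′
              (x∈p∪⁅y⁆⁻ S (subst (_ ∈_) (sym Sb≡Rx) (p⊆p∪q _ y∈R))))
      ... | no b≢x = ⊥-elim (<⇒≱ R<S (maximal (S≡ , b≪S , subst (Face Γ) (sym Sb≡Rx) Rx∈Γ)))
        where
        x∈S : x ∈ S
        x∈S = [ id , (λ x≡b → ⊥-elim (b≢x (sym x≡b))) ]′
          (x∈p∪⁅y⁆⁻ S (subst (x ∈_) (sym Sb≡Rx) (y∈p∪⁅y⁆ R)))
        R<S : w R < w S
        R<S = wt-< κ x∈S x∉R λ {y} y∈R →
          [ inj₁ , (λ { refl → inj₂ (b≪S x∈S) }) ]′
            (x∈p∪⁅y⁆⁻ S (subst (y ∈_) (sym Sb≡Rx) (p⊆p∪q _ y∈R)))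

      St : Subset N
      St = vertices (star R Γ)

      ∈St⁻ : ∀ {x} → x ∈ St → Face Γ (R ∪ ⁅ x ⁆)
      ∈St⁻ = ∈-vertices⁻ (star R Γ)

      -- If `H = S ∪ ⁅ b ⁆` were missing, the invariant would give `w R ≤ w S` and `R ≢ S`. But `S`
      -- omits some `u ∈ R` and gains only vertices below all of `R`, so it is lighter.
      St⊆Γ : ∀ {H} → H ⊆ St → ∣ H ∣ ≡ suc d → Face Δ H → Face Γ H
      St⊆Γ {H} H⊆St H≡ H∈Δ with split-min κ κ-injective H H≡
      ... | S , b , S≡ , b≪S , refl = decidable-stable (Face? Γ H) λ H∉Γ →
        let R≤S , R≢S = proj₂ inv ridge (S≡ , b≪S , H∈Δ) H∉Γ
            u , u∈R , u∉S = ⊈⇒∃∉ {p = R} {S} λ R⊆S →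
              R≢S (p⊆q∧∣q∣≤∣p∣⇒p≡q R⊆S (≤-reflexive (trans S≡ (sym ∣R∣≡d))))
        in <⇒≱ (wt-< κ u∈R u∉S λ {x} x∈S → below u∈R (H⊆St (p⊆p∪q _ x∈S))) R≤S
        where
        below : ∀ {u x} → u ∈ R → x ∈ St → x ∈ R ⊎ κ x < κ u
        below {x = x} u∈R x∈St with x ∈? R
        ... | yes x∈R = inj₁ x∈R
        ... | no x∉R  = inj₂ (nbr≪R x∉R (∈St⁻ x∈St) u∈R)

      -- All neighbours lie below `R`, so every d-face on `R` has the same maximum `v`, the largest
      -- vertex of `R`. Completeness makes the `suc d`-subsets of the star faces of `Δ`, and `St⊆Γ`
      -- returns them to `Γ`.
      simplicial : IsSimplicial d Γ R
      simplicial = downClosed Γ (p⊆p∪q _) R∪a∈Γ , isClique⁺ Γ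
        (≤-trans (≤-reflexive (sym (∣R∪x∣ (≪⇒∉ κ a≪R)))) (p⊆q⇒∣p∣≤∣q∣ Ra⊆St))
        λ H⊆St H≡ → St⊆Γ H⊆St H≡ (topFacets-complete Δ dim chordal {v} cover H⊆St H≡)
        where
        Ra⊆St : R ∪ ⁅ a ⁆ ⊆ St
        Ra⊆St x∈ = ∈-vertices⁺ (star R Γ) (downClosed Γ (∪-⊆ (p⊆p∪q _) (⁅x⁆⊆p x∈)) R∪a∈Γ)
        topR = ∃-top κ (0<∣p∣⇒Nonempty (subst (0 <_) (sym ∣R∣≡d) 0<1+n))
        v = proj₁ topR
        v∈R = proj₁ (proj₂ topR)
        topFacet : ∀ {x} → x ∉ R → Face Γ (R ∪ ⁅ x ⁆) → TopFacet Δ d κ v (R ∪ ⁅ x ⁆)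
        topFacet x∉R Rx∈Γ = proj₁ inv Rx∈Γ , ∣R∪x∣ x∉R , p⊆p∪q _ v∈R , λ y∈ →
          [ proj₂ (proj₂ topR) , (λ { refl → <⇒≤ (nbr≪R x∉R Rx∈Γ v∈R) }) ]′ (x∈p∪⁅y⁆⁻ R y∈)
        cover : ∀ {x} → x ∈ St → ∃[ A ] TopFacet Δ d κ v A × x ∈ A
        cover {x} x∈St with x ∈? R
        ... | yes x∈R = R ∪ ⁅ a ⁆ , topFacet (≪⇒∉ κ a≪R) R∪a∈Γ , p⊆p∪q _ x∈R
        ... | no x∉R  = R ∪ ⁅ x ⁆ , topFacet x∉R (∈St⁻ x∈St) , y∈p∪⁅y⁆ R

      -- A d-face `T ∪ ⁅ c ⁆` lost now contains `R`. If `c ∈ R`, its one vertex outside `R` would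
      -- lie below its minimum `c`; hence `T` is `R`, which is heaviest and contained in no
      -- surviving face.
      inv-abdel : Inv (abdel R Γ)
      inv-abdel = proj₁ inv ∘ abdel-⊆ Γ , λ Sb Tc Tc∉ → compare Sb Tc Tc∉ (Face? Γ _)
        where
        compare : ∀ {S b T c} → Ridge (abdel R Γ) S b → Ridge Δ T c →
                  ¬ Face (abdel R Γ) (T ∪ ⁅ c ⁆) → Dec (Face Γ (T ∪ ⁅ c ⁆)) → w S ≤ w T × S ≢ T
        compare (S≡ , b≪S , Sb∈) Tc _ (no Tc∉Γ) = proj₂ inv (S≡ , b≪S , abdel-⊆ Γ Sb∈) Tc Tc∉Γ
        compare {S} {b} {T} {c} (S≡ , b≪S , Sb∈) (T≡ , c≪T , _) Tc∉ (yes Tc∈Γ) =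
          subst (λ R → w S ≤ w R × S ≢ R) R≡T
            ( maximal (S≡ , b≪S , abdel-⊆ Γ Sb∈)
            , λ { refl → abdel-⊈ Γ Sb∈ (p⊆p∪q _) })
          where
          ∣Tc∣≡ : ∣ T ∪ ⁅ c ⁆ ∣ ≡ suc d
          ∣Tc∣≡ = trans (∣p∪⁅x⁆∣ T (≪⇒∉ κ c≪T)) (cong suc T≡)
          R⊆Tc : R ⊆ T ∪ ⁅ c ⁆
          R⊆Tc = decidable-stable (R ⊆? T ∪ ⁅ c ⁆) λ R⊈ → Tc∉ (maxDim⇒∈abdel Γ dimΓ Tc∈Γ ∣Tc∣≡ R⊈)
          c∉R : c ∉ R
          c∉R c∈R =
            let x , x∈ , x∉R = ∣p∣<∣q∣⇒∃∉ {p = R} {T ∪ ⁅ c ⁆}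
                  (≤-reflexive (trans (cong suc ∣R∣≡d) (sym ∣Tc∣≡)))
                x<c = nbr≪R x∉R (downClosed Γ (∪-⊆ R⊆Tc (⁅x⁆⊆p x∈)) Tc∈Γ) c∈R
            in [ (λ x∈T → <-asym x<c (c≪T x∈T))
               , (λ x≡c → x∉R (subst (_∈ R) (sym x≡c) c∈R))
               ]′ (x∈p∪⁅y⁆⁻ T x∈)
          R≡T : R ≡ T
          R≡T = p⊆q∧∣q∣≤∣p∣⇒p≡q
            (λ x∈R → [ id , (λ { refl → ⊥-elim (c∉R x∈R) }) ]′ (x∈p∪⁅y⁆⁻ T (R⊆Tc x∈R)))
            (≤-reflexive (trans T≡ (sym ∣R∣≡d)))

    step : ∀ {Γ} → Inv Γ → DimAtMost j Γ ⊎ ∃[ Γ′ ] (j , d ⊢ Γ ⟶ Γ′) × Inv Γ′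
    step {Γ} inv with anySubset? (Ridge? Γ)
    ... | yes ∃R with R , (a , ridge) , maximal ← maximise anySubset? (Ridge? Γ) w (w ⊤)
                        (λ R _ → weight-mono _ (⊆⊤ {p = R})) ∃R
      = inj₂ (abdel R Γ ,
              delete R (proj₁ ridge) (simplicial Γ inv ridge (λ r → maximal _ (_ , r))) ,
              inv-abdel Γ inv ridge (λ r → maximal _ (_ , r)))
    ... | no none = inj₁ λ F F∈Γ → ≮⇒≥ λ d<F →
      let R , a , R≡ , a≪R , Ra≡F =
            split-min κ κ-injective F (≤-antisym (dim F (proj₁ inv F∈Γ)) d<F)
      in none (R , a , R≡ , a≪R , subst (Face Γ) (sym Ra≡F) F∈Γ)

  ridgeReduce : ∃[ Γ ] Star (j , d ⊢_⟶_) Δ Γ × DimAtMost j Γ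
  ridgeReduce = reduce Inv step (id , λ { _ (_ , _ , Sb∈Δ) Sb∉Δ → ⊥-elim (Sb∉Δ Sb∈Δ) })

eChordal⇒ridgeChordal : (Δ : SimplicialComplex N) {d : ℕ} → HasDim d Δ → 1 ≤ d →
                        EChordal Δ → RidgeChordal Δ
eChordal⇒ridgeChordal Δ {suc j} hasDim _ chordal
  with κ , κ-injective , chordalBy ← eChordal⇒eChordalBy Δ chordal
  = j , hasDim , suc j , hasDim , ≤-refl , ridgeReduce Δ (proj₁ hasDim) κ κ-injective chordalBy

-- Pure E-chordal complexes are vertex-chordal.

module _ (Δ : SimplicialComplex N) {d : ℕ} (dim : DimAtMost d Δ)
         (κ : Fin N → ℕ) (κ-injective : Inj κ) (chordal : EChordalBy κ Δ) where

  private
    -- The second clause preserves purity, so that d-faces cover each star; the third guarantees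
    -- that no d-face on remaining vertices has been lost.
    Inv : SimplicialComplex N → Set
    Inv Γ = (∀ {F} → Face Γ F → Face Δ F)
          × (∀ {F} → Face Γ F → ∃[ G ] F ⊆ G × Face Γ G × ∣ G ∣ ≡ suc d)
          × (∀ {F} → Face Δ F → ∣ F ∣ ≡ suc d → ¬ Face Γ F →
             ∃[ x ] x ∈ F × (∀ {y} → y ∈ vertices Γ → κ y < κ x))

    module _ (Γ : SimplicialComplex N) (inv : Inv Γ) {v} (topv : Top κ (vertices Γ) v) where

      Γ⊆Δ = proj₁ inv
      extend = proj₁ (proj₂ inv)
      missing = proj₂ (proj₂ inv)
      v∈Γ = ∈-vertices⁻ Γ (proj₁ topv)

      dimΓ : DimAtMost d Γ
      dimΓ F F∈Γ = dim F (Γ⊆Δ F∈Γ)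

      St : Subset N
      St = vertices (star ⁅ v ⁆ Γ)

      ∈St⁻ : ∀ {x} → x ∈ St → Face Γ (⁅ v ⁆ ∪ ⁅ x ⁆)
      ∈St⁻ = ∈-vertices⁻ (star ⁅ v ⁆ Γ)

      cover : ∀ {x} → x ∈ St → ∃[ A ] TopFacet Δ d κ v A × x ∈ A
      -- Purity extends the face on `v` and `x` to a d-face of `Γ`, in which `v` is largest because
      -- it is largest in `Γ`.
      cover x∈St with A , vx⊆A , A∈Γ , A≡ ← extend (∈St⁻ x∈St)
        = A , (Γ⊆Δ A∈Γ , A≡ , vx⊆A (p⊆p∪q _ (x∈⁅x⁆ v)) ,
               λ y∈A → proj₂ topv (x∈face⇒vertex Γ A∈Γ y∈A))
        , vx⊆A (y∈p∪⁅y⁆ ⁅ v ⁆)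

      -- A missing `H` would contain a vertex above all vertices of `Γ`, while its own vertices
      -- still belong to `Γ`.
      full : ∀ {H} → H ⊆ St → ∣ H ∣ ≡ suc d → Face Γ H
      full {H} H⊆St H≡ = decidable-stable (Face? Γ H) λ H∉Γ →
        let x , x∈H , above = missing (topFacets-complete Δ dim chordal {v} cover H⊆St H≡) H≡ H∉Γ
        in <-irrefl refl (above (x∈face⇒vertex Γ (∈St⁻ (H⊆St x∈H)) (y∈p∪⁅y⁆ ⁅ v ⁆)))

      simplicial : IsSimplicial d Γ ⁅ v ⁆
      simplicial with A , v⊆A , A∈Γ , A≡ ← extend v∈Γ
        = v∈Γ , isClique⁺ Γ (≤-trans (≤-reflexive (sym A≡)) (p⊆q⇒∣p∣≤∣q∣ λ x∈A →
            ∈-vertices⁺ (star ⁅ v ⁆ Γ) (downClosed Γ (∪-⊆ v⊆A (⁅x⁆⊆p x∈A)) A∈Γ))) full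

      inv-abdel : Inv (abdel ⁅ v ⁆ Γ)
      inv-abdel = Γ⊆Δ ∘ abdel-⊆ Γ , extend′ , missing′
        where
        extend′ : ∀ {F} → Face (abdel ⁅ v ⁆ Γ) F →
                  ∃[ G ] F ⊆ G × Face (abdel ⁅ v ⁆ Γ) G × ∣ G ∣ ≡ suc d
        extend′ (G , (Gf , v⊈G) , F⊆G) with K , G⊆K , K∈Γ , K≡ ← extend (proj₁ Gf)
          with refl ← facet-≡ Γ Gf K∈Γ G⊆K = G , F⊆G , facet∈abdel Γ Gf v⊈G , K≡
        v∉ : v ∉ vertices (abdel ⁅ v ⁆ Γ)
        v∉ v∈ = abdel-⊈ Γ (∈-vertices⁻ (abdel ⁅ v ⁆ Γ) v∈) id
        vertex⊆ : ∀ {y} → y ∈ vertices (abdel ⁅ v ⁆ Γ) → y ∈ vertices Γ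
        vertex⊆ y∈ = ∈-vertices⁺ Γ (abdel-⊆ Γ (∈-vertices⁻ (abdel ⁅ v ⁆ Γ) y∈))
        missing′ : ∀ {F} → Face Δ F → ∣ F ∣ ≡ suc d → ¬ Face (abdel ⁅ v ⁆ Γ) F →
                   ∃[ x ] x ∈ F × (∀ {y} → y ∈ vertices (abdel ⁅ v ⁆ Γ) → κ y < κ x)
        missing′ {F} F∈Δ F≡ F∉ with Face? Γ F
        ... | no F∉Γ with x , x∈F , above ← missing F∈Δ F≡ F∉Γ = x , x∈F , above ∘ vertex⊆
        -- A d-face lost in this step contains `v`, which was the largest vertex and is now gone.
        ... | yes F∈Γ = v
          , decidable-stable (v ∈? F) (λ v∉F →
              F∉ (maxDim⇒∈abdel Γ dimΓ F∈Γ F≡ λ v⊆F → v∉F (v⊆F (x∈⁅x⁆ v))))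
          , λ y∈ → ≤∧≢⇒< (proj₂ topv (vertex⊆ y∈)) λ eq → v∉ (subst (_∈ _) (κ-injective eq) y∈)

    step : ∀ {Γ} → Inv Γ → DimAtMost 0 Γ ⊎ ∃[ Γ′ ] (0 , d ⊢ Γ ⟶ Γ′) × Inv Γ′
    step {Γ} inv with nonempty? (vertices Γ)
    ... | yes nonempty with v , topv ← ∃-top κ nonempty
      = inj₂ (abdel ⁅ v ⁆ Γ ,
              delete ⁅ v ⁆ (∣⁅x⁆∣≡1 v) (simplicial Γ inv topv) , inv-abdel Γ inv topv)
    -- Elimination stops only when no vertex is left, and then every face is empty.
    ... | no empty = inj₁ λ F F∈Γ → ≮⇒≥ λ 1<F →
      let x , x∈F = 0<∣p∣⇒Nonempty (<-trans 0<1+n 1<F) in empty (x , x∈face⇒vertex Γ F∈Γ x∈F)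

  vertexReduce : (∀ {F} → Face Δ F → ∃[ G ] F ⊆ G × Face Δ G × ∣ G ∣ ≡ suc d) →
                 ∃[ Γ ] Star (0 , d ⊢_⟶_) Δ Γ × DimAtMost 0 Γ
  vertexReduce pure = reduce Inv step (id , pure , λ F∈Δ _ F∉Δ → ⊥-elim (F∉Δ F∈Δ))

pure⇒eChordal⇒vertexChordal : (Δ : SimplicialComplex N) {d : ℕ} → HasDim d Δ → 1 ≤ d → Pure Δ →
                              EChordal Δ → VertexChordal Δ
pure⇒eChordal⇒vertexChordal Δ {d} hasDim@(dim , D , D∈Δ , D≡) 1≤d pure chordal
  with κ , κ-injective , chordalBy ← eChordal⇒eChordalBy Δ chordal
  = d , hasDim , 1≤d , vertexReduce Δ dim κ κ-injective chordalBy λ F∈Δ →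
      let G , Gf , F⊆G = face⊆facet Δ F∈Δ
      in G , F⊆G , proj₁ Gf , trans (pure G D Gf (maxDim⇒facet Δ dim D∈Δ D≡)) D≡

-- Complexes generated by a list of sets.

generatedBy : List (Subset N) → SimplicialComplex N
generatedBy Fs = record
  { Face       = λ F → Any (F ⊆_) Fs
  ; Face?      = λ F → Any.any? (F ⊆?_) Fs
  ; downClosed = λ F⊆G → Any.map (⊆-trans F⊆G)
  }

module _ {Fs : List (Subset N)} where

  generator⇒face : ∀ {F} → F ∈ˡ Fs → Face (generatedBy Fs) F
  generator⇒face = Any.map λ { refl → id }

  facet⇒generator : ∀ {F} → IsFacet (generatedBy Fs) F → F ∈ˡ Fs
  facet⇒generator Ff@(F∈ , _) with G , G∈Fs , F⊆G ← find F∈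
    with refl ← facet-≡ (generatedBy Fs) Ff (generator⇒face G∈Fs) F⊆G = G∈Fs

  generators⇒dimAtMost : ∀ {d} → All (λ F → ∣ F ∣ ≤ suc d) Fs → DimAtMost d (generatedBy Fs)
  generators⇒dimAtMost sizes F F∈ with G , G∈Fs , F⊆G ← find F∈ =
    ≤-trans (p⊆q⇒∣p∣≤∣q∣ F⊆G) (All.lookup sizes G∈Fs)

-- An E-chordal complex that is not vertex-chordal.

module TriangleWithSpokes where

  triangle : Subset 4
  triangle = outside ∷ ⊤

  spoke : Fin 3 → Subset 4
  spoke i = inside ∷ ⁅ i ⁆

  generators : List (Subset 4)
  generators = triangle ∷ List.map spoke (allFin 3)

  Δ : SimplicialComplex 4
  Δ = generatedBy generators

  hasDim : HasDim 2 Δ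
  hasDim = generators⇒dimAtMost (from-yes (All.all? (λ F → ∣ F ∣ ≤? 3) generators))
         , triangle , here id , refl

  top-spoke : ∀ i {v} → Top toℕ (spoke i) v → v ≡ suc i
  top-spoke i (here , top)     with () ← top (there (x∈⁅x⁆ i))
  top-spoke i (there v∈i , _) = cong suc (x∈⁅y⁆⇒x≡y i v∈i)

  -- With the apex `0F` lowest, the spokes have distinct maxima, and the triangle differs from them
  -- in size; no two facets are ever compared.
  eChordal : EChordal Δ
  eChordal = eChordalBy⇒eChordal Δ Fin.toℕ-injective λ Ff Gf F≢G F≡G topF topG _ _ →
    ⊥-elim (absurd (facet⇒generator Ff) (facet⇒generator Gf) F≢G F≡G topF topG)
    where
    size : ∀ {F} → F ∈ˡ List.map spoke (allFin 3) → ∣ F ∣ ≡ 2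
    size F∈ with i , _ , refl ← ∈-map⁻ spoke {xs = allFin 3} F∈ = cong suc (∣⁅x⁆∣≡1 i)
    absurd : ∀ {F G v} → F ∈ˡ generators → G ∈ˡ generators →
             F ≢ G → ∣ F ∣ ≡ ∣ G ∣ → Top toℕ F v → ¬ Top toℕ G v
    absurd (here refl) (here refl) F≢G _ _ _ = F≢G refl
    absurd (here refl) (there G∈) _ F≡G _ _ with () ← trans F≡G (size G∈)
    absurd (there F∈) (here refl) _ F≡G _ _ with () ← trans (sym F≡G) (size F∈)
    absurd (there F∈) (there G∈) F≢G _ topF topG
      with i , _ , refl ← ∈-map⁻ spoke {xs = allFin 3} F∈
         | k , _ , refl ← ∈-map⁻ spoke {xs = allFin 3} G∈
      = F≢G (cong spoke (Fin.suc-injective (trans (sym (top-spoke i topF)) (top-spoke k topG))))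

  -- Any two vertices are adjacent, so a simplicial vertex would make all four vertices a clique.
  -- The apex with two corners of the triangle is no face.
  ¬vertexChordal : ¬ VertexChordal Δ
  ¬vertexChordal (d , _ , _ , Γ , ε , dimΓ) with s≤s () ← dimΓ triangle (here id)
  ¬vertexChordal (d , (dim , _) , _ , Γ , delete S ∣S∣≡1 (_ , _ , clique) ◅ _ , _)
    with u , u∈S ← 0<∣p∣⇒Nonempty (subst (0 <_) (sym ∣S∣≡1) 0<1+n)
    with refl ← ∣p∣≤1⇒p≡⁅x⁆ {p = S} (≤-reflexive ∣S∣≡1) u∈S
    = from-no (Face? Δ (∁ ⁅ 3F ⁆)) (clique 2 (s≤s⁻¹ (dim triangle (here id))) (∁ ⁅ 3F ⁆)
        (λ {x} _ → ∈-vertices⁺ (star ⁅ u ⁆ Δ) (adjacent u x)) refl)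
    where
    adjacent : ∀ u x → Face Δ (⁅ u ⁆ ∪ ⁅ x ⁆)
    adjacent = from-yes (Fin.all? λ u → Fin.all? λ x → Face? Δ (⁅ u ⁆ ∪ ⁅ x ⁆))

-- A ridge-chordal complex that is not E-chordal.

module TriangleOnSquare where

  edge : Fin 6 → Fin 6 → Subset 6
  edge u v = ⁅ u ⁆ ∪ ⁅ v ⁆

  triangle square : Subset 6
  triangle = ⁅ 0F ⁆ ∪ edge 4F 5F
  square   = edge 0F 1F ∪ edge 2F 3F

  edges : List (Subset 6)
  edges = edge 0F 1F ∷ edge 1F 2F ∷ edge 2F 3F ∷ edge 3F 0F ∷ []

  Δ : SimplicialComplex 6
  Δ = generatedBy (triangle ∷ edges)

  hasDim : HasDim 2 Δ
  hasDim = generators⇒dimAtMost (from-yes (All.all? (λ F → ∣ F ∣ ≤? 3) (triangle ∷ edges)))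
         , triangle , here id , refl

  ridgeChordal : RidgeChordal Δ
  ridgeChordal = 1 , hasDim , 2 , hasDim , ≤-refl , abdel (edge 4F 5F) Δ
    , delete (edge 4F 5F) refl (from-yes (Face? Δ (edge 4F 5F)) , isClique⁺ Δ ≤-refl full) ◅ ε , dim
    where
    full : ∀ {H} → H ⊆ vertices (star (edge 4F 5F) Δ) → ∣ H ∣ ≡ 3 → Face Δ H
    -- The edge lies in no other facet, so the vertex set of its star evaluates to `triangle`.
    full H⊆ _ = here H⊆
    dim : DimAtMost 1 (abdel (edge 4F 5F) Δ)
    dim F (G , (Gf , R⊈G) , F⊆G) with facet⇒generator Gf
    ... | here refl = ⊥-elim (R⊈G (q⊆p∪q ⁅ 0F ⁆ (edge 4F 5F)))
    ... | there G∈  = ≤-trans (p⊆q⇒∣p∣≤∣q∣ F⊆G)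
            (All.lookup (from-yes (All.all? (λ F → ∣ F ∣ ≤? 2) edges)) G∈)

  -- The two edges of the square at its largest vertex have the same maximum, and E-chordality would
  -- make the diagonal between their other ends a face.
  ¬eChordal : ¬ EChordal Δ
  ¬eChordal chordal with κ , _ , chordalBy ← eChordal⇒eChordalBy Δ chordal
    = refute (∃-top κ (0F , here))
    where
    -- Collects the conditions that do not involve the labeling, so that they are settled by
    -- evaluation.
    Corner : (a v b : Fin 6) → Set
    Corner a v b =
        (IsFacet Δ (edge v a) × edge v a ⊆ square)
      × (IsFacet Δ (edge v b) × edge v b ⊆ square)
      × edge v a ≢ edge v b
      × ∣ edge v a ∣ ≡ ∣ edge v b ∣
      × ∣ edge a b ∣ ≡ ∣ edge v a ∣
      × ¬ Face Δ (edge a b)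
    corner? : ∀ a v b → Dec (Corner a v b)
    corner? a v b =
            (isFacet? Δ (edge v a) ×-dec edge v a ⊆? square)
      ×-dec (isFacet? Δ (edge v b) ×-dec edge v b ⊆? square)
      ×-dec ¬? (edge v a ≟ˢ edge v b)
      ×-dec ∣ edge v a ∣ ≟ ∣ edge v b ∣
      ×-dec ∣ edge a b ∣ ≟ ∣ edge v a ∣
      ×-dec ¬? (Face? Δ (edge a b))
    ¬top : ∀ a v b → Corner a v b → ¬ Top κ square v
    ¬top a v b ((Ff , F⊆) , (Gf , G⊆) , F≢G , F≡G , H≡F , H∉Δ) (_ , top) =
      H∉Δ (chordalBy Ff Gf F≢G F≡G (x∈edge , top ∘ F⊆) (x∈edge , top ∘ G⊆)
             (∪-⊆ (⁅x⁆⊆p (p⊆p∪q _ (y∈p∪⁅y⁆ ⁅ v ⁆)))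
                  (⁅x⁆⊆p (q⊆p∪q (edge v a) _ (y∈p∪⁅y⁆ ⁅ v ⁆)))) H≡F)
      where
      x∈edge : ∀ {a} → v ∈ edge v a
      x∈edge = p⊆p∪q _ (x∈⁅x⁆ v)
    refute : ¬ (∃[ v ] Top κ square v)
    refute (0F , top) = ¬top 3F 0F 1F (from-yes (corner? 3F 0F 1F)) top
    refute (1F , top) = ¬top 0F 1F 2F (from-yes (corner? 0F 1F 2F)) top
    refute (2F , top) = ¬top 1F 2F 3F (from-yes (corner? 1F 2F 3F)) top
    refute (3F , top) = ¬top 2F 3F 0F (from-yes (corner? 2F 3F 0F)) top
    refute (4F , there (there (there (there ()))) , _)
    refute (5F , there (there (there (there (there ())))) , _)

theorem88 : (∀ {N} (Δ : SimplicialComplex N) (d : ℕ) → HasDim d Δ → 1 ≤ d →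
    (VertexChordal Δ → EChordal Δ) × (EChordal Δ → RidgeChordal Δ))
    × (∃[ N ] Σ[ Δ ∈ SimplicialComplex N ] ∃[ d ] HasDim d Δ × 1 ≤ d ×
    EChordal Δ × ¬ VertexChordal Δ)
    × (∃[ N ] Σ[ Δ ∈ SimplicialComplex N ] ∃[ d ] HasDim d Δ × 1 ≤ d ×
    RidgeChordal Δ × ¬ EChordal Δ)
    × (∀ {N} (Δ : SimplicialComplex N) (d : ℕ) → HasDim d Δ → 1 ≤ d →
    Pure Δ → VertexChordal Δ ⇔ EChordal Δ)
theorem88 =
    (λ Δ d hasDim 1≤d → vertexChordal⇒eChordal Δ , eChordal⇒ridgeChordal Δ hasDim 1≤d)
  , (let open TriangleWithSpokes in 4 , Δ , 2 , hasDim , s≤s z≤n , eChordal , ¬vertexChordal)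
  , (let open TriangleOnSquare in 6 , Δ , 2 , hasDim , s≤s z≤n , ridgeChordal , ¬eChordal)
  , (λ Δ d hasDim 1≤d pure →
       mk⇔ (vertexChordal⇒eChordal Δ) (pure⇒eChordal⇒vertexChordal Δ hasDim 1≤d pure))
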